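{- Let $m,n\ge 1$ be integers, at least one of which is even. Then $$\gamma_1^{\mathrm L}(P_m\square P_n)=\frac{mn}{2}.$$
   Context: All graphs are finite and simple; $N_G(u)$ is the open neighborhood of $u$ in $G$, and $P_n$ is the path on $n$ vertices. A set $D\subseteq V(G)$ is a dominating set if every vertex of $V(G)\setminus D$ has a neighbor in $D$. A dominating set $D$ of $G$ is a $1$-limited dominating set if $|N_G(u)\setminus D|\le 1$ for every $u\in D$. The $1$-limited domination number $\gamma_1^{\mathrm L}(G)$ is the minimum cardinality of a $1$-limited dominating set of $G$. The Cartesian product $G\square H$ has vertex set $V(G)\times V(H)$, with $(g,h)$ and $(g',h')$ adjacent if and only if either $g=g'$ and $hh'\in E(H)$, or $h=h'$ and $gg'\in E(G)$. -}

module Defs where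

open import Data.Bool using (Bool; T; not; _∧_)
open import Data.Fin using (Fin; toℕ)
open import Data.Fin.Properties using (*↔×; inj⇒≟)
open import Data.Fin.Subset using (∣_∣)
open import Data.Nat using (ℕ; suc; _≤_; _*_)
import Data.Nat.Properties as ℕ
open import Data.Product using (_×_; _,_; ∃-syntax)
open import Data.Product.Function.NonDependent.Propositional using (_×-↔_)
open import Data.Sum using (_⊎_; inj₁; inj₂; swap; map)
open import Data.Vec using (tabulate)
open import Function using (_∘_; _↔_; Inverse)
open import Function.Construct.Composition using (_↔-∘_)
open import Function.Construct.Identity using (↔-id)
open import Function.Properties.Inverse using (↔-sym; ↔⇒↣)
open import Level using (0ℓ)
open import Relation.Binary using (Rel; Decidable; DecidableEquality; Symmetric; Irreflexive)
open import Relation.Binary.PropositionalEquality using (_≡_; refl; sym)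
open import Relation.Nullary using (¬_; does; _×-dec_; _⊎-dec_)

record Graph : Set₁ where
  field
    V      : Set
    order  : ℕ
    enum   : Fin order ↔ V
    Adj    : Rel V 0ℓ
    adj?   : Decidable Adj
    adjSym : Symmetric Adj
    noLoop : Irreflexive _≡_ Adj

  _≟ᵥ_ : DecidableEquality V
  _≟ᵥ_ = inj⇒≟ (↔⇒↣ (↔-sym enum))

  VertexSet : Set
  VertexSet = V → Bool

  infix 4 _∈_ _∉_
  infixl 6 _∖_

  _∈_ _∉_ : V → VertexSet → Set
  v ∈ S = T (S v)
  v ∉ S = ¬ (v ∈ S)

  _∖_ : VertexSet → VertexSet → VertexSet
  (S ∖ R) v = S v ∧ not (R v)

  card : VertexSet → ℕ
  card S = ∣ tabulate (S ∘ Inverse.to enum) ∣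

  N : V → VertexSet
  N u v = does (adj? u v)

module _ (G : Graph) where
  open Graph G

  IsDominating : VertexSet → Set
  IsDominating D = ∀ v → v ∉ D → ∃[ u ] (u ∈ N v × u ∈ D)

  Is1LimitedDominating : VertexSet → Set
  Is1LimitedDominating D =
    IsDominating D × (∀ u → u ∈ D → card (N u ∖ D) ≤ 1)

  -- γ₁ᴸ(G) = k, as a relation in k.
  Is-γ₁ᴸ : ℕ → Set
  Is-γ₁ᴸ k =
    (∃[ D ] (Is1LimitedDominating D × card D ≡ k)) ×
    (∀ D → Is1LimitedDominating D → k ≤ card D)

infixr 7 _□_

_□_ : Graph → Graph → Graph
G □ H = record
  { V      = G.V × H.V
  ; order  = G.order * H.order
  ; enum   = (G.enum ×-↔ H.enum) ↔-∘ *↔×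
  ; Adj    = λ (g , h) (g′ , h′) →
               (g ≡ g′ × H.Adj h h′) ⊎ (h ≡ h′ × G.Adj g g′)
  ; adj?   = λ (g , h) (g′ , h′) →
               ((g G.≟ᵥ g′) ×-dec H.adj? h h′) ⊎-dec ((h H.≟ᵥ h′) ×-dec G.adj? g g′)
  ; adjSym = map (λ (e , a) → sym e , H.adjSym a) (λ (e , a) → sym e , G.adjSym a)
  ; noLoop = λ { refl (inj₁ (_ , a)) → H.noLoop refl a
               ; refl (inj₂ (_ , a)) → G.noLoop refl a }
  }
  where
  module G = Graph G
  module H = Graph H

P : ℕ → Graph
P n = record
  { V      = Fin n
  ; order  = n
  ; enum   = ↔-id (Fin n)
  ; Adj    = λ i j → suc (toℕ i) ≡ toℕ j ⊎ suc (toℕ j) ≡ toℕ i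
  ; adj?   = λ i j → (suc (toℕ i) ℕ.≟ toℕ j) ⊎-dec (suc (toℕ j) ℕ.≟ toℕ i)
  ; adjSym = swap
  ; noLoop = λ { refl (inj₁ e) → ℕ.1+n≢n e
               ; refl (inj₂ e) → ℕ.1+n≢n e }
  }

{-# OPTIONS --safe #-}
-- If D is 1-limited dominating, every vertex outside D has a neighbour in D, and no vertex of D
-- is used twice, so |V ∖ D| ≤ |D|.  Now let D be one side of a perfect matching cut: each vertex
-- has exactly one neighbour across the cut.  Then D and V ∖ D are both 1-limited dominating, so
-- both have |V|/2 elements and this is optimal.  The even path has the perfect matching cut
-- {0,3,4,7,8,…}, and pulling a perfect matching cut back along a projection of a Cartesian
-- product gives one of the product.
module Submission where

open import Defs
open import Data.Bool using (Bool; true; false; T; not)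
open import Data.Bool.Properties using (T-≡; T-∧; ¬-not; not-involutive)
open import Data.Fin using (Fin; suc; toℕ; fromℕ<; _≟_)
open import Data.Fin.Properties using (suc-injective; toℕ-fromℕ<; toℕ-injective; toℕ<n)
open import Data.Fin.Subset using (Subset; inside; outside; _∈_; _⊆_; ⁅_⁆; _-_)
  renaming (∣_∣ to size)
open import Data.Fin.Subset.Properties
  using (x∈⁅x⁆; ∣⁅x⁆∣≡1; p⊆q⇒∣p∣≤∣q∣; p─q⊆p; x∈p⇒∣p-x∣<∣p∣; x∈p∧x≢y⇒x∈p-y; ∣∁p∣≡n∸∣p∣; ∣p∣≤n)
open import Data.Nat using (ℕ; suc; z≤n; s≤s; s<s⁻¹; _≤_; _<_; _+_; _*_; _/_)
open import Data.Nat.Divisibility using (_∣_; divides-refl)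
open import Data.Nat.DivMod using (m*n/n≡m; /-monoˡ-≤)
import Data.Nat.Properties as ℕ
open import Data.Product using (_×_; _,_; ∃-syntax; proj₁; proj₂; map₁; map₂)
open import Data.Sum using (_⊎_; inj₁; inj₂)
open import Data.Vec using ([]; _∷_; here; there; tabulate)
open import Data.Vec.Properties using (lookup∘tabulate; lookup⇒[]=; []=⇒lookup; tabulate-∘; tabulate-cong)
open import Function using (_∘_; Inverse; Equivalence)
open import Relation.Binary.PropositionalEquality
  using (_≡_; _≢_; refl; sym; trans; cong; subst)
open import Relation.Nullary using (¬_; Dec; does; yes; no; contradiction)
open import Relation.Nullary.Decidable using (dec-true)

open Equivalence using () renaming (to to ⇔-to; from to ⇔-from)

T-does⁺ : ∀ {A : Set} (a? : Dec A) → A → T (does a?)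
T-does⁺ a? a = ⇔-from T-≡ (dec-true a? a)

T-does⁻ : ∀ {A : Set} (a? : Dec A) → T (does a?) → A
T-does⁻ (yes a) _ = a

T-not⁻ : ∀ {b} → T (not b) → ¬ T b
T-not⁻ {false} _ ()

∣p∣≤1⇒unique : ∀ {n} {p : Subset n} {i j} → size p ≤ 1 → i ∈ p → j ∈ p → i ≡ j
∣p∣≤1⇒unique {i = i} {j} p≤1 i∈p j∈p with j ≟ i
... | yes j≡i = sym j≡i
... | no j≢i  = contradiction (ℕ.≤-<-trans z≤n ∣p-i-j∣<∣p-i∣) (ℕ.≤⇒≯ ∣p-i∣≤0)
  where
  ∣p-i-j∣<∣p-i∣ = x∈p⇒∣p-x∣<∣p∣ (x∈p∧x≢y⇒x∈p-y j∈p j≢i)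
  ∣p-i∣≤0 = ℕ.≤-pred (ℕ.≤-trans (x∈p⇒∣p-x∣<∣p∣ i∈p) p≤1)

-- Greedy induction on `p`: its first element takes a match `j₀`, which is deleted from `q`.
-- Injectivity of `R` keeps the later elements from being related to `j₀`, so totality survives the
-- deletion.
∣p∣≤∣q∣-by-matching : ∀ {m n} (p : Subset m) (q : Subset n) (R : Fin m → Fin n → Set) →
  (∀ {i} → i ∈ p → ∃[ j ] (j ∈ q × R i j)) →
  (∀ {i i′ j} → i ∈ p → i′ ∈ p → j ∈ q → R i j → R i′ j → i ≡ i′) →
  size p ≤ size q
∣p∣≤∣q∣-by-matching []            q R total inj = z≤n
∣p∣≤∣q∣-by-matching (outside ∷ p) q R total inj =
  ∣p∣≤∣q∣-by-matching p q (R ∘ suc) (total ∘ there)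
    λ i∈ i′∈ j∈ r r′ → suc-injective (inj (there i∈) (there i′∈) j∈ r r′)
∣p∣≤∣q∣-by-matching (inside ∷ p) q R total inj with j₀ , j₀∈q , r₀ ← total here =
  ℕ.≤-<-trans
    (∣p∣≤∣q∣-by-matching p (q - j₀) (R ∘ suc) total′
      λ i∈ i′∈ j∈ r r′ → suc-injective (inj (there i∈) (there i′∈) (p─q⊆p q ⁅ j₀ ⁆ j∈) r r′))
    (x∈p⇒∣p-x∣<∣p∣ j₀∈q)
  where
  total′ : ∀ {i} → i ∈ p → ∃[ j ] (j ∈ q - j₀ × R (suc i) j)
  total′ i∈p with j , j∈q , r ← total (there i∈p) =
    j , x∈p∧x≢y⇒x∈p-y j∈q (λ { refl → contradiction (inj here (there i∈p) j₀∈q r₀ r) λ () }) , r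

module _ (G : Graph) where
  open Graph G hiding (_∈_)

  private
    to = Inverse.to enum
    from = Inverse.from enum

  -- `card S` is by definition the size of this subset, which opens the way to the counting lemmas
  -- for `Subset`.
  indices : VertexSet → Subset order
  indices S = tabulate (S ∘ to)

  ∈-indices⁺ : ∀ S {i} → T (S (to i)) → i ∈ indices S
  ∈-indices⁺ S {i} s = lookup⇒[]= i _ (trans (lookup∘tabulate (S ∘ to) i) (⇔-to T-≡ s))

  ∈-indices⁻ : ∀ S {i} → i ∈ indices S → T (S (to i))
  ∈-indices⁻ S {i} i∈S =
    ⇔-from T-≡ (trans (sym (lookup∘tabulate (S ∘ to) i)) ([]=⇒lookup i∈S))

  card≤1 : ∀ S w → (∀ v → T (S v) → v ≡ w) → card S ≤ 1
  card≤1 S w unique = subst (card S ≤_) (∣⁅x⁆∣≡1 (from w)) (p⊆q⇒∣p∣≤∣q∣ indices⊆)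
    where
    indices⊆ : indices S ⊆ ⁅ from w ⁆
    indices⊆ {i} i∈S = subst (λ j → i ∈ ⁅ j ⁆)
      (sym (Inverse.inverseʳ enum (sym (unique (to i) (∈-indices⁻ S i∈S)))))
      (x∈⁅x⁆ i)

  card-complement : ∀ S → card (not ∘ S) + card S ≡ order
  card-complement S = trans
    (cong (_+ card S) (trans (cong size (tabulate-∘ not (S ∘ to))) (∣∁p∣≡n∸∣p∣ (indices S))))
    (ℕ.m∸n+n≡m (∣p∣≤n (indices S)))

  card-complement≤card : ∀ {D} → Is1LimitedDominating G D → card (not ∘ D) ≤ card D
  card-complement≤card {D} (dominating , limited) =
    ∣p∣≤∣q∣-by-matching (indices (not ∘ D)) (indices D) (λ i j → Adj (to j) (to i)) total inj
    where
    total : ∀ {i} → i ∈ indices (not ∘ D) → ∃[ j ] (j ∈ indices D × Adj (to j) (to i))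
    total {i} i∉D
      with u , u∈N , u∈D ← dominating (to i)
             (T-not⁻ (∈-indices⁻ (not ∘ D) i∉D)) =
      from u , ∈-indices⁺ D (subst (T ∘ D) u≡ u∈D)
      -- Domination places `u` in the neighbourhood of the outside vertex, while the limit concerns
      -- the neighbourhood of `u`; hence the symmetry.
      , subst (λ w → Adj w (to i)) u≡ (adjSym (T-does⁻ (adj? (to i) u) u∈N))
      where u≡ = sym (Inverse.inverseˡ enum refl)

    inj : ∀ {i i′ j} → i ∈ indices (not ∘ D) → i′ ∈ indices (not ∘ D) → j ∈ indices D →
          Adj (to j) (to i) → Adj (to j) (to i′) → i ≡ i′
    inj {j = j} i∉D i′∉D j∈D a a′ =
      -- Two outside vertices matched to the same `j` both lie in `N (to j) ∖ D`, which has at most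
      -- one element.
      ∣p∣≤1⇒unique (limited (to j) (∈-indices⁻ D j∈D)) (∈N∖D i∉D a) (∈N∖D i′∉D a′)
      where
      ∈N∖D : ∀ {i} → i ∈ indices (not ∘ D) → Adj (to j) (to i) → i ∈ indices (N (to j) ∖ D)
      ∈N∖D {i} i∉D a = ∈-indices⁺ (N (to j) ∖ D)
        (⇔-from T-∧ (T-does⁺ (adj? (to j) (to i)) a , ∈-indices⁻ (not ∘ D) i∉D))

  order/2≤card : ∀ {D} → Is1LimitedDominating G D → order / 2 ≤ card D
  order/2≤card {D} D-1LD = subst (order / 2 ≤_) (m*n/n≡m (card D) 2) (/-monoˡ-≤ 2 order≤)
    where
    open ℕ.≤-Reasoning
    order≤ : order ≤ card D * 2
    order≤ = begin
      order                  ≡⟨ card-complement D ⟨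
      card (not ∘ D) + card D ≤⟨ ℕ.+-monoˡ-≤ (card D) (card-complement≤card D-1LD) ⟩
      card D + card D        ≡⟨ cong (card D +_) (ℕ.+-identityʳ (card D)) ⟨
      2 * card D             ≡⟨ ℕ.*-comm 2 (card D) ⟩
      card D * 2             ∎

  -- Crossing is phrased through Boolean values rather than membership, so the two sides play
  -- symmetric roles and negation exchanges them.
  record IsPerfectMatchingCut (D : VertexSet) : Set where
    field
      partner        : V → V
      partner-adj    : ∀ v → Adj v (partner v)
      partner-across : ∀ v → D (partner v) ≡ not (D v)
      partner-unique : ∀ {v w} → Adj v w → D v ≢ D w → w ≡ partner v

  open IsPerfectMatchingCut

  complement-cut : ∀ {D} → IsPerfectMatchingCut D → IsPerfectMatchingCut (not ∘ D)
  complement-cut cut = record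
    { partner        = partner cut
    ; partner-adj    = partner-adj cut
    ; partner-across = λ v → cong not (partner-across cut v)
    ; partner-unique = λ a ne → partner-unique cut a (ne ∘ cong not)
    }

  -- The partner of a vertex outside `D` dominates it, and the partner of a vertex in `D` is its
  -- only neighbour outside.
  cut⇒1LimitedDominating : ∀ {D} → IsPerfectMatchingCut D → Is1LimitedDominating G D
  cut⇒1LimitedDominating {D} cut = dominating , limited
    where
    dominating : IsDominating G D
    dominating v v∉D =
      partner cut v , T-does⁺ (adj? v _) (partner-adj cut v)
      , ⇔-from T-≡ (trans (partner-across cut v) (sym (¬-not (v∉D ∘ ⇔-from T-≡ ∘ sym))))

    limited : ∀ u → T (D u) → card (N u ∖ D) ≤ 1
    limited u u∈D = card≤1 (N u ∖ D) (partner cut u) λ w w∈ →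
      let w∈N , w∉D = ⇔-to T-∧ w∈ in
      partner-unique cut (T-does⁻ (adj? u w) w∈N)
        λ Du≡Dw → T-not⁻ w∉D (subst T Du≡Dw u∈D)

  -- The counting inequality for the complement is the reverse of the one for `D`; together they
  -- force `order` to be twice `card D`.
  cut⇒γ₁ᴸ : ∀ {D} → IsPerfectMatchingCut D → Is-γ₁ᴸ G (order / 2)
  cut⇒γ₁ᴸ {D} cut = (D , D-1LD , cardD≡) , λ _ → order/2≤card
    where
    D-1LD = cut⇒1LimitedDominating cut
    ∁D-1LD = cut⇒1LimitedDominating (complement-cut cut)

    cardD≤card∁D : card D ≤ card (not ∘ D)
    cardD≤card∁D = subst (_≤ card (not ∘ D))
      -- The double complement agrees with `D` only pointwise.
      (cong size (tabulate-cong (not-involutive ∘ D ∘ to))) (card-complement≤card ∁D-1LD)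

    open ℕ.≤-Reasoning
    cardD≤ : card D * 2 ≤ order
    cardD≤ = begin
      card D * 2              ≡⟨ ℕ.*-comm (card D) 2 ⟩
      2 * card D              ≡⟨ cong (card D +_) (ℕ.+-identityʳ (card D)) ⟩
      card D + card D         ≤⟨ ℕ.+-monoˡ-≤ (card D) cardD≤card∁D ⟩
      card (not ∘ D) + card D ≡⟨ card-complement D ⟩
      order                   ∎

    cardD≡ : card D ≡ order / 2
    cardD≡ = ℕ.≤-antisym
      (subst (_≤ order / 2) (m*n/n≡m (card D) 2) (/-monoˡ-≤ 2 cardD≤))
      (order/2≤card D-1LD)

open IsPerfectMatchingCut

-- Edges along `H` fix the first coordinate and so never cross; the crossing edges are copies of
-- those in `G`. The other projection is symmetric.
□-cutˡ : ∀ G H {D} → IsPerfectMatchingCut G D → IsPerfectMatchingCut (G □ H) (D ∘ proj₁)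
□-cutˡ G H cut = record
  { partner        = map₁ (partner cut)
  ; partner-adj    = λ (g , _) → inj₂ (refl , partner-adj cut g)
  ; partner-across = λ (g , _) → partner-across cut g
  ; partner-unique = λ { (inj₁ (refl , _)) ne → contradiction refl ne
                       ; (inj₂ (refl , a)) ne → cong (_, _) (partner-unique cut a ne) }
  }

□-cutʳ : ∀ G H {D} → IsPerfectMatchingCut H D → IsPerfectMatchingCut (G □ H) (D ∘ proj₂)
□-cutʳ G H cut = record
  { partner        = map₂ (partner cut)
  ; partner-adj    = λ (_ , h) → inj₁ (refl , partner-adj cut h)
  ; partner-across = λ (_ , h) → partner-across cut h
  ; partner-unique = λ { (inj₁ (refl , a)) ne → cong (_ ,_) (partner-unique cut a ne)
                       ; (inj₂ (refl , _)) ne → contradiction refl ne }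
  }

-- The pattern has period four: a shift by two negates it. It changes inside each block `2j, 2j+1`
-- and stays constant from one block to the next.
colour : ℕ → Bool
colour 0             = true
colour 1             = false
colour (suc (suc i)) = not (colour i)

-- The involution exchanging `2j` and `2j+1`.
mate : ℕ → ℕ
mate 0             = 1
mate 1             = 0
mate (suc (suc i)) = suc (suc (mate i))

mate-adj : ∀ i → suc i ≡ mate i ⊎ suc (mate i) ≡ i
mate-adj 0 = inj₁ refl
mate-adj 1 = inj₂ refl
mate-adj (suc (suc i)) with mate-adj i
... | inj₁ e = inj₁ (cong (2 +_) e)
... | inj₂ e = inj₂ (cong (2 +_) e)

colour-mate : ∀ i → colour (mate i) ≡ not (colour i)
colour-mate 0             = refl
colour-mate 1             = refl
colour-mate (suc (suc i)) = cong not (colour-mate i)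

-- Both conclusions come from the same edge, since it may be traversed from either end.
mate-unique : ∀ i → colour i ≢ colour (suc i) → suc i ≡ mate i × i ≡ mate (suc i)
mate-unique 0             ne = refl , refl
mate-unique 1             ne = contradiction refl ne
mate-unique (suc (suc i)) ne with e , e′ ← mate-unique i (ne ∘ cong not) =
  cong (2 +_) e , cong (2 +_) e′

-- Evenness enters here: the last vertex has an odd index, so its mate precedes it. With an odd
-- number of vertices its mate would fall off the path.
mate<2k : ∀ k {i} → i < k * 2 → mate i < k * 2
mate<2k (suc k) {0}           _   = s≤s (s≤s z≤n)
mate<2k (suc k) {1}           _   = s≤s z≤n
mate<2k (suc k) {suc (suc i)} i<  = s≤s (s≤s (mate<2k k (s<s⁻¹ (s<s⁻¹ i<))))

even-path-cut : ∀ k → IsPerfectMatchingCut (P (k * 2)) (colour ∘ toℕ)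
even-path-cut k = record
  { partner        = p
  ; partner-adj    = λ i → subst (λ j → suc (toℕ i) ≡ j ⊎ suc j ≡ toℕ i)
                             (sym (toℕ-p i)) (mate-adj (toℕ i))
  ; partner-across = λ i → trans (cong colour (toℕ-p i)) (colour-mate (toℕ i))
  ; partner-unique = λ {i} a ne → toℕ-injective (trans (unique a ne) (sym (toℕ-p i)))
  }
  where
  p : Fin (k * 2) → Fin (k * 2)
  p i = fromℕ< (mate<2k k (toℕ<n i))

  toℕ-p : ∀ i → toℕ (p i) ≡ mate (toℕ i)
  toℕ-p i = toℕ-fromℕ< (mate<2k k (toℕ<n i))

  unique : ∀ {i j} → suc i ≡ j ⊎ suc j ≡ i → colour i ≢ colour j → j ≡ mate i
  unique (inj₁ refl) ne = proj₁ (mate-unique _ ne)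
  unique (inj₂ refl) ne = proj₂ (mate-unique _ (ne ∘ sym))

lemma13 : (m n : ℕ) → 1 ≤ m → 1 ≤ n → 2 ∣ m ⊎ 2 ∣ n → Is-γ₁ᴸ (P m □ P n) (m * n / 2)
-- Matching on `divides-refl k` turns the even factor into `k * 2`, and the order of the product is
-- `m * n` by definition.
lemma13 m n _ _ (inj₁ (divides-refl k)) =
  cut⇒γ₁ᴸ (P m □ P n) (□-cutˡ (P m) (P n) (even-path-cut k))
lemma13 m n _ _ (inj₂ (divides-refl k)) =
  cut⇒γ₁ᴸ (P m □ P n) (□-cutʳ (P m) (P n) (even-path-cut k))
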